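{- Let $\alpha,\beta\ge 1$. For the problem of scheduling with uncertain processing times on a single machine with the objective of minimizing the total completion time, the competitive ratio of the algorithm $(\alpha,\beta)$-PCP is at most $$\max\left\{\alpha\left(1+\tfrac1\beta\right),\ 1+\tfrac1\alpha+\tfrac1\beta+\tfrac1{\alpha\beta},\ \beta,\ 2,\ 1+\tfrac2\alpha\right\}.$$
   Context: Problem. There are $n$ jobs, all available at time $0$. Job $j$ has a testing time $t_j\ge 0$, an upper limit $u_j\ge 0$, and a real processing time $p_j\in[0,u_j]$. A job may be executed untested, which takes $u_j$ time units, or it may be tested (taking $t_j$ time units) and later executed in $p_j$ time units; other tasks may run between the test and the execution. A single machine runs one task at a time. The completion time of a job is the time at which its execution (or execution-untested) ends, and the cost of a schedule is the sum of the completion times of all jobs. An online algorithm knows all $t_j,u_j$ from the start, but learns $p_j$ only when the test of $j$ is finished. $\mathrm{OPT}$ knows all $p_j$ in advance (but must still test $j$ in order to run it in time $p_j$), and its cost is the minimum cost of any schedule; it spends $p_j^*=\min\{u_j,t_j+p_j\}$ on job $j$ and runs jobs in non-decreasing order of $p_j^*$. The competitive ratio of an online algorithm $A$ is the smallest $c$ such that $\mathrm{cost}(A)\le c\cdot \mathrm{cost}(\mathrm{OPT})$ on all instances. Algorithm $(\alpha,\beta)$-PCP (Prioritizing-Certain-Processing-time). Maintain a priority queue of tasks, smaller weight meaning higher priority (ties broken arbitrarily). Initially, for each job $j$: if $u_j\ge\alpha t_j$, insert a testing task of weight $\beta t_j$; otherwise insert an execution-untested task of weight $u_j$. While the queue is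 nonempty, extract a task of smallest weight and run it; if it was the testing task of job $j$, then after the test insert an execution task for $j$ with weight $t_j+p_j$ (running this execution task takes $p_j$ time). -}

module Defs where

open import Algebra.Bundles using (CommutativeRing)
open import Algebra.Core using (Op₁; Op₂)
import Algebra.Construct.NaturalChoice.Max as Max
import Algebra.Properties.CommutativeMonoid.Sum as Sum
open import Data.Bool.Base using (Bool; true; false; if_then_else_)
open import Data.Fin.Base using (Fin)
open import Data.Fin.Properties using (_≟_)
open import Data.List.Base using (List; []; _∷_; _++_; map; filter; allFin)
open import Data.List.Relation.Binary.Permutation.Propositional using (_↭_)
open import Data.List.Relation.Unary.All using (All)
open import Data.Nat.Base using (ℕ)
open import Data.Product.Base using (_×_)
open import Data.Sum.Base using (_⊎_)
open import Data.Unit.Polymorphic.Base using (⊤)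
open import Level using (Level; suc; _⊔_)
open import Relation.Binary.Bundles using (DecTotalOrder)
open import Relation.Binary.Core using (Rel)
open import Relation.Binary.PropositionalEquality.Core using (_≡_)
open import Relation.Binary.Structures using (IsDecTotalOrder)
open import Relation.Nullary.Decidable.Core using (does)
open import Relation.Nullary.Negation.Core using (¬_)

-- Times, weights and the parameters live in an arbitrary linearly ordered
-- field; ℝ (whose order is classically decidable) is an instance.
-- The inverse is a total operation whose value at 0# is unconstrained.

record OrderedField c ℓ₁ ℓ₂ : Set (suc (c ⊔ ℓ₁ ⊔ ℓ₂)) where
  field
    commutativeRing : CommutativeRing c ℓ₁

  open CommutativeRing commutativeRing public
    using (Carrier; _≈_; _+_; _*_; -_; 0#; 1#)

  infix  4 _≤_
  infix  8 _⁻¹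
  field
    _≤_             : Rel Carrier ℓ₂
    isDecTotalOrder : IsDecTotalOrder _≈_ _≤_
    _⁻¹             : Op₁ Carrier
    ⁻¹-cong         : ∀ {x y} → x ≈ y → x ⁻¹ ≈ y ⁻¹
    ⁻¹-inverseʳ     : ∀ {x} → ¬ (x ≈ 0#) → x * x ⁻¹ ≈ 1#
    0#≉1#           : ¬ (0# ≈ 1#)
    +-monoˡ-≤       : ∀ {x y} z → x ≤ y → x + z ≤ y + z
    *-nonNeg        : ∀ {x y} → 0# ≤ x → 0# ≤ y → 0# ≤ x * y

  decTotalOrder : DecTotalOrder c ℓ₁ ℓ₂
  decTotalOrder = record { isDecTotalOrder = isDecTotalOrder }

  open DecTotalOrder decTotalOrder public using (_≤?_; totalOrder)

  open Max totalOrder public using () renaming (_⊔_ to max)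

  open Sum (CommutativeRing.+-commutativeMonoid commutativeRing) public
    using (sum)

  infixl 7 _÷_
  _÷_ : Op₂ Carrier
  x ÷ y = x * y ⁻¹

  2# : Carrier
  2# = 1# + 1#

module Scheduling {c ℓ₁ ℓ₂} (F : OrderedField c ℓ₁ ℓ₂) where

  open OrderedField F

  record Instance (n : ℕ) : Set (c ⊔ ℓ₂) where
    field
      t u p : Fin n → Carrier
      t≥0   : ∀ j → 0# ≤ t j
      u≥0   : ∀ j → 0# ≤ u j
      p≥0   : ∀ j → 0# ≤ p j
      p≤u   : ∀ j → p j ≤ u j

  data Task (n : ℕ) : Set where
    test exec untested : Fin n → Task n

  job : ∀ {n} → Task n → Fin n
  job (test j)     = j
  job (exec j)     = j
  job (untested j) = j

  completes : ∀ {n} → Fin n → Task n → Bool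
  completes j (test i)     = false
  completes j (exec i)     = does (i ≟ j)
  completes j (untested i) = does (i ≟ j)

  record Slot (n : ℕ) : Set c where
    constructor _at_
    field
      task  : Task n
      start : Carrier

  open Slot public

  -- The slots are listed in the order in which the machine processes them.
  Schedule : ℕ → Set c
  Schedule n = List (Slot n)

  module _ {n} (I : Instance n) where

    open Instance I

    duration : Task n → Carrier
    duration (test j)     = t j
    duration (exec j)     = p j
    duration (untested j) = u j

    finish : Slot n → Carrier
    finish s = start s + duration (task s)

    -- Tasks do not overlap, and none starts before `now`.  Idling is allowed.
    NonOverlapping : Carrier → Schedule n → Set ℓ₂
    NonOverlapping now []      = ⊤
    NonOverlapping now (s ∷ σ) = now ≤ start s × NonOverlapping (finish s) σ

    tasksOf : Fin n → Schedule n → List (Task n)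
    tasksOf j σ = filter (λ τ → job τ ≟ j) (map task σ)

    record Feasible (σ : Schedule n) : Set ℓ₂ where
      field
        nonOverlapping : NonOverlapping 0# σ
        eachJob        : ∀ j → tasksOf j σ ≡ untested j ∷ []
                             ⊎ tasksOf j σ ≡ test j ∷ exec j ∷ []

    -- In a feasible schedule every job is completed by exactly one slot, so
    -- the value 0# for a job that is never completed does not matter.
    completionTime : Fin n → Schedule n → Carrier
    completionTime j []      = 0#
    completionTime j (s ∷ σ) =
      if completes j (task s) then finish s else completionTime j σ

    cost : Schedule n → Carrier
    cost σ = sum (λ j → completionTime j σ)

    record IsOptimal (opt : Schedule n) : Set (c ⊔ ℓ₂) where
      field
        feasible : Feasible opt
        minimum  : ∀ σ → Feasible σ → cost opt ≤ cost σ

  -- An algorithm is given by the schedules it may produce on each instance;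
  -- there can be several because of arbitrary tie-breaking.
  Algorithm : (ℓ : Level) → Set (c ⊔ ℓ₂ ⊔ suc ℓ)
  Algorithm ℓ = ∀ {n} → Instance n → Schedule n → Set ℓ

  IsCompetitive : ∀ {ℓ} → Algorithm ℓ → Carrier → Set (c ⊔ ℓ₂ ⊔ ℓ)
  IsCompetitive A r =
    ∀ {n} (I : Instance n) (σ opt : Schedule n) →
    A I σ → IsOptimal I opt → cost I σ ≤ r * cost I opt

  record IsCompetitiveRatio {ℓ} (A : Algorithm ℓ) (r : Carrier)
                            : Set (c ⊔ ℓ₂ ⊔ ℓ) where
    field
      competitive : IsCompetitive A r
      smallest    : ∀ r′ → IsCompetitive A r′ → r ≤ r′

  record Entry (n : ℕ) : Set c where
    constructor _weighing_
    field
      task   : Task n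
      weight : Carrier

  Queue : ℕ → Set c
  Queue n = List (Entry n)

  module _ {n} (I : Instance n) where

    open Instance I

    initialEntry : (α β : Carrier) → Fin n → Entry n
    initialEntry α β j =
      if does (α * t j ≤? u j)
      then test j weighing (β * t j)
      else untested j weighing u j

    initialQueue : (α β : Carrier) → Queue n
    initialQueue α β = map (initialEntry α β) (allFin n)

    insertedAfter : Task n → Queue n
    insertedAfter (test j)     = exec j weighing (t j + p j) ∷ []
    insertedAfter (exec j)     = []
    insertedAfter (untested j) = []

    -- Run now q σ: starting at time `now` with queue q, the algorithm may
    -- produce the schedule σ.  Any entry of minimal weight may be extracted.
    data Run (now : Carrier) : Queue n → Schedule n → Set (c ⊔ ℓ₂) where
      done : Run now [] []
      step : ∀ {q τ w q′ σ} →
             q ↭ (τ weighing w) ∷ q′ →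
             All (λ e → w ≤ Entry.weight e) q′ →
             Run (now + duration I τ) (insertedAfter τ ++ q′) σ →
             Run now q ((τ at now) ∷ σ)

  PCP : (α β : Carrier) → Algorithm (c ⊔ ℓ₂)
  PCP α β I = Run I 0# (initialQueue I α β)

-- A job completes no earlier than the total work done on all jobs up to its
-- completion, and exactly then if the machine never idles, as under PCP.  Hence
-- twice the cost compares with a sum over ordered pairs (j, k) of the work on j
-- done until k completes plus the work on k done until j completes.  For j ≠ k
-- this is at least p*ⱼ or p*ₖ in a feasible schedule, according to which of the
-- two jobs completes first.  For PCP it is at most the claimed ratio times
-- either of p*ⱼ and p*ₖ: follow the order in which the tasks of j and k leave
-- the queue and compare their weights, using tⱼ ≤ uⱼ/α if j is tested and
-- uⱼ ≤ α tⱼ if it is not.  So the ratio holds pair by pair.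
module Submission where

open import Defs
open import Algebra.Bundles using (CommutativeRing)
import Algebra.Construct.NaturalChoice.Max as Max
import Algebra.Properties.CommutativeMonoid.Sum as Sum
import Algebra.Properties.Semiring.Sum as SemiringSum
import Algebra.Solver.Ring.NaturalCoefficients.Default as Solver
open import Data.Bool.Base using (true; false; if_then_else_)
open import Data.Fin.Base using (Fin; zero; suc)
open import Data.Fin.Properties using (_≟_)
open import Data.List.Base using (List; []; _∷_; _++_; map; filter; foldr)
open import Data.List.Membership.Propositional using (_∈_)
open import Data.List.Membership.Propositional.Properties using (∈-allFin)
open import Data.List.Properties
  using (filter-accept; filter-reject; ∷-injective)
open import Data.List.Relation.Binary.Permutation.Propositional using (_↭_; ↭-sym)
open import Data.List.Relation.Binary.Permutation.Propositional.Properties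
  using (filter-↭; ↭-singleton-inv; ↭-empty-inv)
open import Data.List.Relation.Unary.All as All using (All; []; _∷_)
open import Data.List.Relation.Unary.All.Properties using (filter⁺)
open import Data.List.Relation.Unary.AllPairs using ([]; _∷_)
open import Data.List.Relation.Unary.Any using (here; there)
open import Data.List.Relation.Unary.Unique.Propositional using (Unique)
open import Data.List.Relation.Unary.Unique.Propositional.Properties using (allFin⁺)
open import Data.Nat.Base using (ℕ)
open import Data.Product.Base using (_×_; _,_)
open import Data.Sum.Base as ⊎ using (_⊎_; inj₁; inj₂)
open import Function.Base using (_∘_)
open import Level using (_⊔_)
open import Relation.Binary.Bundles using (DecTotalOrder)
import Relation.Binary.Reasoning.PartialOrder as PartialOrderReasoning
open import Relation.Binary.PropositionalEquality as ≡ using (_≡_; _≢_)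
open import Relation.Nullary.Decidable.Core using (yes; no; does)
open import Relation.Nullary.Negation.Core using (¬_; contradiction)

-- Arithmetic in an ordered field.

module OrderedFieldProperties {c ℓ₁ ℓ₂} (F : OrderedField c ℓ₁ ℓ₂) where

  open OrderedField F
  open CommutativeRing commutativeRing public
    using ( +-cong; +-congˡ; +-congʳ; +-identityˡ; +-identityʳ; +-comm; +-assoc
          ; -‿inverseʳ; -‿inverseˡ
          ; *-cong; *-congˡ; *-congʳ; *-identityˡ; *-comm; *-assoc; distribˡ; zeroʳ; zeroˡ
          ; commutativeSemiring; semiring; +-commutativeMonoid )
    renaming (refl to ≈-refl; sym to ≈-sym; trans to ≈-trans)
  open DecTotalOrder decTotalOrder public
    using (poset; total)
    renaming (refl to ≤-refl; trans to ≤-trans; reflexive to ≤-reflexive; antisym to ≤-antisym)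
  open Solver commutativeSemiring public using (solve; _:+_; _:*_; _:=_; con)
  open PartialOrderReasoning poset public

  +-monoʳ-≤ : ∀ {x y} z → x ≤ y → z + x ≤ z + y
  +-monoʳ-≤ {x} {y} z x≤y = begin
    z + x ≈⟨ +-comm z x ⟩
    x + z ≤⟨ +-monoˡ-≤ z x≤y ⟩
    y + z ≈⟨ +-comm y z ⟩
    z + y ∎

  +-mono-≤ : ∀ {w x y z} → w ≤ x → y ≤ z → w + y ≤ x + z
  +-mono-≤ {x = x} {y} w≤x y≤z = ≤-trans (+-monoˡ-≤ y w≤x) (+-monoʳ-≤ x y≤z)

  x≤x+y : ∀ {x y} → 0# ≤ y → x ≤ x + y
  x≤x+y {x} {y} 0≤y = begin
    x      ≈⟨ +-identityʳ x ⟨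
    x + 0# ≤⟨ +-monoʳ-≤ x 0≤y ⟩
    x + y  ∎

  x≤y+x : ∀ {x y} → 0# ≤ y → x ≤ y + x
  x≤y+x {x} {y} 0≤y = ≤-trans (x≤x+y 0≤y) (≤-reflexive (+-comm x y))

  +-nonNeg : ∀ {x y} → 0# ≤ x → 0# ≤ y → 0# ≤ x + y
  +-nonNeg 0≤x 0≤y = ≤-trans 0≤x (x≤x+y 0≤y)

  x+z-z≈x : ∀ x z → x + z + - z ≈ x
  x+z-z≈x x z = begin-equality
    x + z + - z   ≈⟨ +-assoc x z (- z) ⟩
    x + (z + - z) ≈⟨ +-congˡ (-‿inverseʳ z) ⟩
    x + 0#        ≈⟨ +-identityʳ x ⟩
    x             ∎

  +-cancelʳ-≤ : ∀ {x y} z → x + z ≤ y + z → x ≤ y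
  +-cancelʳ-≤ {x} {y} z x+z≤y+z = begin
    x           ≈⟨ x+z-z≈x x z ⟨
    x + z + - z ≤⟨ +-monoˡ-≤ (- z) x+z≤y+z ⟩
    y + z + - z ≈⟨ x+z-z≈x y z ⟩
    y           ∎

  -- If `y ≤ x`, then `x + x ≤ y + y ≤ y + x`, and one `x` cancels. This removes the factor two that
  -- arises from summing over ordered pairs of jobs.
  double-cancel-≤ : ∀ {x y} → x + x ≤ y + y → x ≤ y
  double-cancel-≤ {x} {y} 2x≤2y with total x y
  ... | inj₁ x≤y = x≤y
  ... | inj₂ y≤x = +-cancelʳ-≤ x (≤-trans 2x≤2y (+-monoʳ-≤ y y≤x))

  *-monoˡ-≤-nonNeg : ∀ {x y z} → 0# ≤ z → x ≤ y → z * x ≤ z * y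
  *-monoˡ-≤-nonNeg {x} {y} {z} 0≤z x≤y = begin
    z * x                   ≤⟨ x≤y+x (*-nonNeg 0≤z 0≤y-x) ⟩
    z * (y + - x) + z * x   ≈⟨ distribˡ z (y + - x) x ⟨
    z * (y + - x + x)       ≈⟨ *-congˡ (+-assoc y (- x) x) ⟩
    z * (y + (- x + x))     ≈⟨ *-congˡ (+-congˡ (-‿inverseˡ x)) ⟩
    z * (y + 0#)            ≈⟨ *-congˡ (+-identityʳ y) ⟩
    z * y                   ∎
    where
    0≤y-x : 0# ≤ y + - x
    0≤y-x = begin
      0#      ≈⟨ -‿inverseʳ x ⟨
      x + - x ≤⟨ +-monoˡ-≤ (- x) x≤y ⟩
      y + - x ∎

  *-monoʳ-≤-nonNeg : ∀ {x y z} → 0# ≤ z → x ≤ y → x * z ≤ y * z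
  *-monoʳ-≤-nonNeg {x} {y} {z} 0≤z x≤y = begin
    x * z ≈⟨ *-comm x z ⟩
    z * x ≤⟨ *-monoˡ-≤-nonNeg 0≤z x≤y ⟩
    z * y ≈⟨ *-comm z y ⟩
    y * z ∎

  0≤x² : ∀ x → 0# ≤ x * x
  0≤x² x with total 0# x
  ... | inj₁ 0≤x = *-nonNeg 0≤x 0≤x
  ... | inj₂ x≤0 = begin
    0#                                    ≤⟨ *-nonNeg 0≤-x 0≤-x ⟩
    - x * - x                             ≈⟨ +-identityˡ (- x * - x) ⟨
    -- The zero `x * (x + - x)` is inserted so that a regrouping valid in every commutative
    -- semiring, with `- x` as a variable, brings out `x * x`.
    0# + - x * - x                        ≈⟨ +-congʳ (zeroʳ x) ⟨
    x * 0# + - x * - x                    ≈⟨ +-congʳ (*-congˡ (-‿inverseʳ x)) ⟨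
    x * (x + - x) + - x * - x             ≈⟨ solve 2 (λ x y → x :* (x :+ y) :+ y :* y := x :* x :+ (x :+ y) :* y) ≈-refl x (- x) ⟩
    x * x + (x + - x) * - x               ≈⟨ +-congˡ (*-congʳ (-‿inverseʳ x)) ⟩
    x * x + 0# * - x                      ≈⟨ +-congˡ (zeroˡ (- x)) ⟩
    x * x + 0#                            ≈⟨ +-identityʳ (x * x) ⟩
    x * x                                 ∎
    where
    0≤-x : 0# ≤ - x
    0≤-x = begin
      0#       ≈⟨ -‿inverseʳ x ⟨
      x + - x  ≤⟨ +-monoˡ-≤ (- x) x≤0 ⟩
      0# + - x ≈⟨ +-identityˡ (- x) ⟩
      - x      ∎

  0≤1 : 0# ≤ 1#
  0≤1 = ≤-trans (0≤x² 1#) (≤-reflexive (*-identityˡ 1#))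

  1≤x⇒0≤x : ∀ {x} → 1# ≤ x → 0# ≤ x
  1≤x⇒0≤x = ≤-trans 0≤1

  1≤x⇒x≉0 : ∀ {x} → 1# ≤ x → ¬ (x ≈ 0#)
  1≤x⇒x≉0 1≤x x≈0 = 0#≉1# (≤-antisym 0≤1 (≤-trans 1≤x (≤-reflexive x≈0)))

  1≤x⇒y≤x*y : ∀ {x y} → 1# ≤ x → 0# ≤ y → y ≤ x * y
  1≤x⇒y≤x*y {x} {y} 1≤x 0≤y = begin
    y      ≈⟨ *-identityˡ y ⟨
    1# * y ≤⟨ *-monoʳ-≤-nonNeg 0≤y 1≤x ⟩
    x * y  ∎

  -- The inverse equals `x * (x ⁻¹ * x ⁻¹)`, a nonnegative element times a square.
  0≤x⁻¹ : ∀ {x} → 1# ≤ x → 0# ≤ x ⁻¹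
  0≤x⁻¹ {x} 1≤x = begin
    0#                 ≤⟨ *-nonNeg (1≤x⇒0≤x 1≤x) (0≤x² (x ⁻¹)) ⟩
    x * (x ⁻¹ * x ⁻¹)  ≈⟨ *-assoc x (x ⁻¹) (x ⁻¹) ⟨
    x * x ⁻¹ * x ⁻¹    ≈⟨ *-congʳ (⁻¹-inverseʳ (1≤x⇒x≉0 1≤x)) ⟩
    1# * x ⁻¹          ≈⟨ *-identityˡ (x ⁻¹) ⟩
    x ⁻¹               ∎

  -- Turns the testing rule `α * t j ≤ u j`, and comparisons of another weight with `β * t k`, into
  -- upper bounds on a testing time.
  x*y≤z⇒y≤x⁻¹*z : ∀ {x y z} → 1# ≤ x → x * y ≤ z → y ≤ x ⁻¹ * z
  x*y≤z⇒y≤x⁻¹*z {x} {y} {z} 1≤x xy≤z = begin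
    y               ≈⟨ *-identityˡ y ⟨
    1# * y          ≈⟨ *-congʳ (⁻¹-inverseʳ (1≤x⇒x≉0 1≤x)) ⟨
    x * x ⁻¹ * y    ≈⟨ solve 3 (λ x i y → x :* i :* y := i :* (x :* y)) ≈-refl x (x ⁻¹) y ⟩
    x ⁻¹ * (x * y)  ≤⟨ *-monoˡ-≤-nonNeg (0≤x⁻¹ 1≤x) xy≤z ⟩
    x ⁻¹ * z        ∎

  1≤x⇒*-cancelˡ-≤ : ∀ {x y z} → 1# ≤ x → x * y ≤ x * z → y ≤ z
  1≤x⇒*-cancelˡ-≤ {x} {y} {z} 1≤x xy≤xz = begin
    y               ≤⟨ x*y≤z⇒y≤x⁻¹*z 1≤x xy≤xz ⟩
    x ⁻¹ * (x * z)  ≈⟨ solve 3 (λ x i z → i :* (x :* z) := x :* i :* z) ≈-refl x (x ⁻¹) z ⟩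
    x * x ⁻¹ * z    ≈⟨ *-congʳ (⁻¹-inverseʳ (1≤x⇒x≉0 1≤x)) ⟩
    1# * z          ≈⟨ *-identityˡ z ⟩
    z               ∎

  -- Splits the summand `1# ÷ (α * β)` of the ratio, so that the sum factors as a product. The
  -- element `x * y` is invertible because `1# ≤ y ≤ x * y`.
  ⁻¹-distrib-* : ∀ {x y} → 1# ≤ x → 1# ≤ y → (x * y) ⁻¹ ≈ x ⁻¹ * y ⁻¹
  ⁻¹-distrib-* {x} {y} 1≤x 1≤y = begin-equality
    (x * y) ⁻¹                             ≈⟨ *-identityˡ _ ⟨
    1# * (x * y) ⁻¹                        ≈⟨ *-congʳ (*-identityˡ 1#) ⟨
    1# * 1# * (x * y) ⁻¹                   ≈⟨ *-congʳ (*-cong (inverse 1≤x) (inverse 1≤y)) ⟨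
    x * x ⁻¹ * (y * y ⁻¹) * (x * y) ⁻¹     ≈⟨ solve 5 (λ x i y j k → x :* i :* (y :* j) :* k := i :* j :* (x :* y :* k)) ≈-refl x (x ⁻¹) y (y ⁻¹) ((x * y) ⁻¹) ⟩
    x ⁻¹ * y ⁻¹ * (x * y * (x * y) ⁻¹)     ≈⟨ *-congˡ (inverse (≤-trans 1≤y (1≤x⇒y≤x*y 1≤x (1≤x⇒0≤x 1≤y)))) ⟩
    x ⁻¹ * y ⁻¹ * 1#                       ≈⟨ *-comm _ 1# ⟩
    1# * (x ⁻¹ * y ⁻¹)                     ≈⟨ *-identityˡ _ ⟩
    x ⁻¹ * y ⁻¹                            ∎
    where
    inverse : ∀ {z} → 1# ≤ z → z * z ⁻¹ ≈ 1#
    inverse 1≤z = ⁻¹-inverseʳ (1≤x⇒x≉0 1≤z)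

  sum-mono-≤ : ∀ {n} {f g : Fin n → Carrier} → (∀ i → f i ≤ g i) → sum f ≤ sum g
  sum-mono-≤ {ℕ.zero}  f≤g = ≤-refl
  sum-mono-≤ {ℕ.suc n} f≤g = +-mono-≤ (f≤g zero) (sum-mono-≤ (f≤g ∘ suc))

  sum-indicator : ∀ {n} (i : Fin n) x → sum (λ k → if does (i ≟ k) then x else 0#) ≈ x
  sum-indicator {ℕ.suc n} zero x = ≈-trans (+-congˡ (Sum.sum-replicate-zero +-commutativeMonoid n)) (+-identityʳ x)
  sum-indicator (suc i) x = ≈-trans (+-identityˡ _) (sum-indicator i x)

-- Work on one job until another completes.

module PairwiseWork {c ℓ₁ ℓ₂} (F : OrderedField c ℓ₁ ℓ₂) {n : ℕ}
                    (I : Scheduling.Instance F n) where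

  open OrderedField F
  open OrderedFieldProperties F
  open Scheduling F
  open Instance I

  infix 4 p*[_]≤_

  -- The paper's p*ⱼ = min {uⱼ, tⱼ + pⱼ} is at most x.
  p*[_]≤_ : Fin n → Carrier → Set ℓ₂
  p*[ j ]≤ x = u j ≤ x ⊎ t j + p j ≤ x

  p*-nonNeg : ∀ {j x} → p*[ j ]≤ x → 0# ≤ x
  p*-nonNeg (inj₁ u≤x)   = ≤-trans (u≥0 _) u≤x
  p*-nonNeg (inj₂ t+p≤x) = ≤-trans (+-nonNeg (t≥0 _) (p≥0 _)) t+p≤x

  duration-nonNeg : ∀ τ → 0# ≤ duration I τ
  duration-nonNeg (test j)     = t≥0 j
  duration-nonNeg (exec j)     = p≥0 j
  duration-nonNeg (untested j) = u≥0 j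

  tasks : Schedule n → List (Task n)
  tasks = map task

  tasksFor : Fin n → List (Task n) → List (Task n)
  tasksFor j = filter (λ τ → job τ ≟ j)

  workOn : Fin n → Task n → Carrier
  workOn k τ = if does (job τ ≟ k) then duration I τ else 0#

  -- Counted up to and including the completion of job j.
  work : Fin n → Fin n → List (Task n) → Carrier
  work k j []       = 0#
  work k j (τ ∷ τs) = workOn k τ + (if completes j τ then 0# else work k j τs)

  pairWork : Fin n → Fin n → List (Task n) → Carrier
  pairWork j k τs = work j k τs + work k j τs

  workOn-own : ∀ {k} {τ : Task n} → job τ ≡ k → workOn k τ ≡ duration I τ
  workOn-own {k} {τ} τ∈k with job τ ≟ k
  ... | yes _   = ≡.refl
  ... | no  τ∉k = contradiction τ∈k τ∉k

  workOn-other : ∀ {k} {τ : Task n} → job τ ≢ k → workOn k τ ≡ 0#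
  workOn-other {k} {τ} τ∉k with job τ ≟ k
  ... | yes τ∈k = contradiction τ∈k τ∉k
  ... | no  _   = ≡.refl

  workOn-nonNeg : ∀ k τ → 0# ≤ workOn k τ
  workOn-nonNeg k τ with job τ ≟ k
  ... | yes _ = duration-nonNeg τ
  ... | no  _ = ≤-refl

  completes⇒job : ∀ {j} (τ : Task n) → completes j τ ≡ true → job τ ≡ j
  completes⇒job {j} (exec i) eq with i ≟ j
  ... | yes i≡j = i≡j
  completes⇒job {j} (untested i) eq with i ≟ j
  ... | yes i≡j = i≡j

  completes-other : ∀ {j} (τ : Task n) → job τ ≢ j → completes j τ ≡ false
  completes-other {j} τ τ∉j with completes j τ in eq
  ... | true  = contradiction (completes⇒job τ eq) τ∉j
  ... | false = ≡.refl

  completes-own : ∀ j (τ : Task n) → job τ ≡ j → τ ≡ test j ⊎ completes j τ ≡ true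
  completes-own j (test i)     ≡.refl = inj₁ ≡.refl
  completes-own j (exec i)     ≡.refl with i ≟ i
  ... | yes _   = inj₂ ≡.refl
  ... | no  i≢i = contradiction ≡.refl i≢i
  completes-own j (untested i) ≡.refl with i ≟ i
  ... | yes _   = inj₂ ≡.refl
  ... | no  i≢i = contradiction ≡.refl i≢i

  work-nonNeg : ∀ k j τs → 0# ≤ work k j τs
  work-nonNeg k j []       = ≤-refl
  work-nonNeg k j (τ ∷ τs) with completes j τ
  ... | true  = +-nonNeg (workOn-nonNeg k τ) ≤-refl
  ... | false = +-nonNeg (workOn-nonNeg k τ) (work-nonNeg k j τs)

  work-skip : ∀ {k j} (τ : Task n) τs → job τ ≢ k → completes j τ ≡ false →
              work k j (τ ∷ τs) ≈ work k j τs
  work-skip {k} {j} τ τs τ∉k eq rewrite workOn-other {k} {τ} τ∉k | eq = +-identityˡ _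

  work-last : ∀ {j} (τ : Task n) τs → completes j τ ≡ true → work j j (τ ∷ τs) ≈ duration I τ
  work-last {j} τ τs eq rewrite workOn-own {j} {τ} (completes⇒job τ eq) | eq = +-identityʳ _

  work-own : ∀ {j k} (τ : Task n) τs → job τ ≡ j → completes k τ ≡ false →
             work j k (τ ∷ τs) ≈ duration I τ + work j k τs
  work-own {j} {k} τ τs τ∈j eq rewrite workOn-own {j} {τ} τ∈j | eq = ≈-refl

  pairWork-comm : ∀ j k τs → pairWork j k τs ≈ pairWork k j τs
  pairWork-comm j k τs = +-comm (work j k τs) (work k j τs)

  pairWork-skip : ∀ {j k} (τ : Task n) τs → job τ ≢ j → job τ ≢ k →
                  pairWork j k (τ ∷ τs) ≈ pairWork j k τs
  pairWork-skip τ τs τ∉j τ∉k =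
    +-cong (work-skip τ τs τ∉j (completes-other τ τ∉k))
           (work-skip τ τs τ∉k (completes-other τ τ∉j))

  -- At the completion of `j` the account of work on `k` until `j` completes is closed, and `τ` adds
  -- nothing to it because it is a task of `j`. Only later work on `j` could still count.
  pairWork-last : ∀ {j k} (τ : Task n) τs → j ≢ k → completes j τ ≡ true →
                  pairWork j k (τ ∷ τs) ≈ duration I τ + work j k τs
  pairWork-last {j} {k} τ τs j≢k eq = begin-equality
    work j k (τ ∷ τs) + work k j (τ ∷ τs)   ≈⟨ +-cong (work-own τ τs τ∈j (completes-other τ τ∉k)) nothing ⟩
    duration I τ + work j k τs + 0#         ≈⟨ +-identityʳ _ ⟩
    duration I τ + work j k τs              ∎
    where
    τ∈j : job τ ≡ j
    τ∈j = completes⇒job τ eq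
    τ∉k : job τ ≢ k
    τ∉k τ∈k = j≢k (≡.trans (≡.sym τ∈j) τ∈k)
    nothing : work k j (τ ∷ τs) ≈ 0#
    nothing rewrite workOn-other {k} {τ} τ∉k | eq = +-identityˡ 0#

  -- A task of `j` is charged once: to the work on `j` until `k` completes, and not to the work on
  -- `k`.
  pairWork-own : ∀ {j k} (τ : Task n) τs → j ≢ k → job τ ≡ j → completes j τ ≡ false →
                 pairWork j k (τ ∷ τs) ≈ duration I τ + pairWork j k τs
  pairWork-own {j} {k} τ τs j≢k τ∈j eq = begin-equality
    work j k (τ ∷ τs) + work k j (τ ∷ τs)         ≈⟨ +-cong (work-own τ τs τ∈j (completes-other τ τ∉k)) (work-skip τ τs τ∉k eq) ⟩
    duration I τ + work j k τs + work k j τs      ≈⟨ +-assoc _ _ _ ⟩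
    duration I τ + (work j k τs + work k j τs)    ∎
    where
    τ∉k : job τ ≢ k
    τ∉k τ∈k = j≢k (≡.trans (≡.sym τ∈j) τ∈k)

  -- Total work, completion times and lower bounds for feasible schedules.

  totalWork : Fin n → List (Task n) → Carrier
  totalWork j τs = sum (λ k → work k j τs)

  totalWork-last : ∀ {j} (τ : Task n) τs → completes j τ ≡ true → totalWork j (τ ∷ τs) ≈ duration I τ
  totalWork-last {j} τ τs eq rewrite eq = begin-equality
    sum (λ k → workOn k τ + 0#)  ≈⟨ Sum.sum-cong-≋ +-commutativeMonoid (λ k → +-identityʳ (workOn k τ)) ⟩
    sum (λ k → workOn k τ)       ≈⟨ sum-indicator (job τ) (duration I τ) ⟩
    duration I τ                 ∎

  totalWork-step : ∀ {j} (τ : Task n) τs → completes j τ ≡ false →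
                   totalWork j (τ ∷ τs) ≈ duration I τ + totalWork j τs
  totalWork-step {j} τ τs eq rewrite eq = begin-equality
    sum (λ k → workOn k τ + work k j τs)   ≈⟨ Sum.∑-distrib-+ +-commutativeMonoid (λ k → workOn k τ) (λ k → work k j τs) ⟩
    sum (λ k → workOn k τ) + totalWork j τs ≈⟨ +-congʳ (sum-indicator (job τ) (duration I τ)) ⟩
    duration I τ + totalWork j τs          ∎

  -- Common form of the two task lists that feasibility allows for a job. Unlike feasibility, it
  -- survives the removal of a test at the head, which makes it usable as an induction hypothesis
  -- along a schedule.
  data EndsInCompletion (j : Fin n) : List (Task n) → Set where
    last : ∀ {τ τs} → completes j τ ≡ true → τs ≡ [] → EndsInCompletion j (τ ∷ τs)
    more : ∀ {τ τs} → completes j τ ≡ false → EndsInCompletion j τs → EndsInCompletion j (τ ∷ τs)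

  tasksFor-own : ∀ {j} (τ : Task n) τs → job τ ≡ j → tasksFor j (τ ∷ τs) ≡ τ ∷ tasksFor j τs
  tasksFor-own {j} τ τs = filter-accept (λ τ′ → job τ′ ≟ j) {x = τ} {xs = τs}

  tasksFor-other : ∀ {j} (τ : Task n) τs → job τ ≢ j → tasksFor j (τ ∷ τs) ≡ tasksFor j τs
  tasksFor-other {j} τ τs = filter-reject (λ τ′ → job τ′ ≟ j) {x = τ} {xs = τs}

  endsInCompletion-other : ∀ {j} (τ : Task n) τs → job τ ≢ j →
                           EndsInCompletion j (tasksFor j (τ ∷ τs)) →
                           EndsInCompletion j (tasksFor j τs)
  endsInCompletion-other {j} τ τs τ∉j = ≡.subst (EndsInCompletion j) (tasksFor-other τ τs τ∉j)

  endsInCompletion-own : ∀ {j} (τ : Task n) τs → job τ ≡ j →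
                         EndsInCompletion j (tasksFor j (τ ∷ τs)) →
                         (completes j τ ≡ true × tasksFor j τs ≡ [])
                         ⊎ (completes j τ ≡ false × EndsInCompletion j (tasksFor j τs))
  endsInCompletion-own {j} τ τs τ∈j ends
    with ≡.subst (EndsInCompletion j) (tasksFor-own τ τs τ∈j) ends
  ... | last eq none  = inj₁ (eq , none)
  ... | more eq ends′ = inj₂ (eq , ends′)

  endsInCompletion-tail : ∀ {j} (τ : Task n) τs → completes j τ ≡ false →
                          EndsInCompletion j (tasksFor j (τ ∷ τs)) →
                          EndsInCompletion j (tasksFor j τs)
  endsInCompletion-tail {j} τ τs eq ends with job τ ≟ j
  ... | no  τ∉j = ends
  ... | yes _ with ends
  ...   | last eq′ _   = contradiction (≡.trans (≡.sym eq) eq′) λ ()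
  ...   | more _ ends′ = ends′

  job? : ∀ (τ : Task n) j → job τ ≡ j ⊎ job τ ≢ j
  job? τ j with job τ ≟ j
  ... | yes τ∈j = inj₁ τ∈j
  ... | no  τ∉j = inj₂ τ∉j

  completes? : ∀ j (τ : Task n) → completes j τ ≡ true ⊎ completes j τ ≡ false
  completes? j τ with completes j τ
  ... | true  = inj₁ ≡.refl
  ... | false = inj₂ ≡.refl

  completionTime-last : ∀ {j} (s : Slot n) σ → completes j (task s) ≡ true →
                        completionTime I j (s ∷ σ) ≡ finish I s
  completionTime-last s σ eq rewrite eq = ≡.refl

  completionTime-step : ∀ {j} (s : Slot n) σ → completes j (task s) ≡ false →
                        completionTime I j (s ∷ σ) ≡ completionTime I j σ
  completionTime-step s σ eq rewrite eq = ≡.refl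

  -- Each slot starts no earlier than the previous one finishes, so idle time only increases the
  -- right side. `EndsInCompletion` excludes the empty schedule, where the default completion time
  -- `0#` could fall below `now`.
  completionTime-lower : ∀ {j now} σ → NonOverlapping I now σ →
                         EndsInCompletion j (tasksFor j (tasks σ)) →
                         now + totalWork j (tasks σ) ≤ completionTime I j σ
  completionTime-lower {j} {now} (s ∷ σ) (now≤ , rest) ends with completes? j (task s)
  ... | inj₁ eq = begin
    now + totalWork j (tasks (s ∷ σ))   ≈⟨ +-congˡ (totalWork-last (task s) (tasks σ) eq) ⟩
    now + duration I (task s)           ≤⟨ +-monoˡ-≤ _ now≤ ⟩
    finish I s                          ≡⟨ completionTime-last s σ eq ⟨
    completionTime I j (s ∷ σ)          ∎
  ... | inj₂ eq = begin
    now + totalWork j (tasks (s ∷ σ))                      ≈⟨ +-congˡ (totalWork-step (task s) (tasks σ) eq) ⟩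
    now + (duration I (task s) + totalWork j (tasks σ))    ≈⟨ +-assoc _ _ _ ⟨
    now + duration I (task s) + totalWork j (tasks σ)      ≤⟨ +-monoˡ-≤ _ (+-monoˡ-≤ _ now≤) ⟩
    finish I s + totalWork j (tasks σ)                     ≤⟨ completionTime-lower σ rest (endsInCompletion-tail (task s) (tasks σ) eq ends) ⟩
    completionTime I j σ                                   ≡⟨ completionTime-step s σ eq ⟨
    completionTime I j (s ∷ σ)                             ∎

  -- On the tasks of job `j` in a feasible schedule this amounts to `u j` or `t j + p j`, hence to
  -- at least the minimum of the two.
  load : List (Task n) → Carrier
  load = foldr (λ τ x → duration I τ + x) 0#

  load-other : ∀ {j} (τ : Task n) τs → job τ ≢ j → load (tasksFor j (τ ∷ τs)) ≡ load (tasksFor j τs)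
  load-other τ τs τ∉j = ≡.cong load (tasksFor-other τ τs τ∉j)

  load-own : ∀ {j} (τ : Task n) τs → job τ ≡ j →
             load (tasksFor j (τ ∷ τs)) ≡ duration I τ + load (tasksFor j τs)
  load-own τ τs τ∈j = ≡.cong load (tasksFor-own τ τs τ∈j)

  load-last : ∀ {j} (τ : Task n) τs → job τ ≡ j → tasksFor j τs ≡ [] →
              load (tasksFor j (τ ∷ τs)) ≈ duration I τ
  load-last {j} τ τs τ∈j none = begin-equality
    load (tasksFor j (τ ∷ τs))         ≡⟨ load-own τ τs τ∈j ⟩
    duration I τ + load (tasksFor j τs) ≡⟨ ≡.cong (λ l → duration I τ + load l) none ⟩
    duration I τ + 0#                  ≈⟨ +-identityʳ _ ⟩
    duration I τ                       ∎

  -- The completing task of `j` is its last one, so no task of `j` lies beyond the point where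
  -- `work j j` stops counting.
  load≤work : ∀ {j} τs → EndsInCompletion j (tasksFor j τs) → load (tasksFor j τs) ≤ work j j τs
  load≤work {j} (τ ∷ τs) ends with job? τ j
  ... | inj₂ τ∉j = begin
    load (tasksFor j (τ ∷ τs)) ≡⟨ load-other τ τs τ∉j ⟩
    load (tasksFor j τs)       ≤⟨ load≤work τs (endsInCompletion-other τ τs τ∉j ends) ⟩
    work j j τs                ≈⟨ work-skip τ τs τ∉j (completes-other τ τ∉j) ⟨
    work j j (τ ∷ τs)          ∎
  ... | inj₁ τ∈j with endsInCompletion-own τ τs τ∈j ends
  ...   | inj₁ (eq , none) = begin
    load (tasksFor j (τ ∷ τs)) ≈⟨ load-last τ τs τ∈j none ⟩
    duration I τ               ≈⟨ work-last τ τs eq ⟨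
    work j j (τ ∷ τs)          ∎
  ...   | inj₂ (eq , ends′) = begin
    load (tasksFor j (τ ∷ τs))          ≡⟨ load-own τ τs τ∈j ⟩
    duration I τ + load (tasksFor j τs) ≤⟨ +-monoʳ-≤ _ (load≤work τs ends′) ⟩
    duration I τ + work j j τs          ≈⟨ work-own τ τs τ∈j eq ⟨
    work j j (τ ∷ τs)                   ∎

  LoadBelow : Fin n → Fin n → List (Task n) → Set ℓ₂
  LoadBelow j k τs = load (tasksFor j τs) ≤ pairWork j k τs ⊎ load (tasksFor k τs) ≤ pairWork j k τs

  LoadBelow-sym : ∀ {j k} τs → LoadBelow j k τs → LoadBelow k j τs
  LoadBelow-sym {j} {k} τs (inj₁ j≤) = inj₂ (≤-trans j≤ (≤-reflexive (pairWork-comm j k τs)))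
  LoadBelow-sym {j} {k} τs (inj₂ k≤) = inj₁ (≤-trans k≤ (≤-reflexive (pairWork-comm j k τs)))

  -- The induction hypothesis is passed as a function because the rest of the list satisfies
  -- `EndsInCompletion j` only if `τ` does not complete `j`. If it does, the load of `j` is just the
  -- duration of `τ`.
  loadBelow-own : ∀ {j k} (τ : Task n) τs → j ≢ k → job τ ≡ j →
                  EndsInCompletion j (tasksFor j (τ ∷ τs)) →
                  (EndsInCompletion j (tasksFor j τs) → LoadBelow j k τs) →
                  LoadBelow j k (τ ∷ τs)
  loadBelow-own {j} {k} τ τs j≢k τ∈j ends below with endsInCompletion-own τ τs τ∈j ends
  ... | inj₁ (eq , none) = inj₁ (begin
    load (tasksFor j (τ ∷ τs))   ≈⟨ load-last τ τs τ∈j none ⟩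
    duration I τ                 ≤⟨ x≤x+y (work-nonNeg j k τs) ⟩
    duration I τ + work j k τs   ≈⟨ pairWork-last τ τs j≢k eq ⟨
    pairWork j k (τ ∷ τs)        ∎)
  ... | inj₂ (eq , ends′) with below ends′
  ...   | inj₁ j≤ = inj₁ (begin
    load (tasksFor j (τ ∷ τs))            ≡⟨ load-own τ τs τ∈j ⟩
    duration I τ + load (tasksFor j τs)   ≤⟨ +-monoʳ-≤ _ j≤ ⟩
    duration I τ + pairWork j k τs        ≈⟨ pairWork-own τ τs j≢k τ∈j eq ⟨
    pairWork j k (τ ∷ τs)                 ∎)
  ...   | inj₂ k≤ = inj₂ (begin
    load (tasksFor k (τ ∷ τs))            ≡⟨ load-other τ τs (λ τ∈k → j≢k (≡.trans (≡.sym τ∈j) τ∈k)) ⟩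
    load (tasksFor k τs)                  ≤⟨ k≤ ⟩
    pairWork j k τs                       ≤⟨ x≤y+x (duration-nonNeg τ) ⟩
    duration I τ + pairWork j k τs        ≈⟨ pairWork-own τ τs j≢k τ∈j eq ⟨
    pairWork j k (τ ∷ τs)                 ∎)

  -- The job that completes first has all its tasks before the completion of the other job, so its
  -- whole load is counted in the work of the pair.
  loadBelow : ∀ {j k} τs → j ≢ k →
              EndsInCompletion j (tasksFor j τs) → EndsInCompletion k (tasksFor k τs) →
              LoadBelow j k τs
  loadBelow {j} {k} (τ ∷ τs) j≢k endsⱼ endsₖ with job? τ j | job? τ k
  ... | inj₁ τ∈j | inj₁ τ∈k = contradiction (≡.trans (≡.sym τ∈j) τ∈k) j≢k
  ... | inj₁ τ∈j | inj₂ τ∉k = loadBelow-own τ τs j≢k τ∈j endsⱼ λ endsⱼ′ →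
    loadBelow τs j≢k endsⱼ′ (endsInCompletion-other τ τs τ∉k endsₖ)
  ... | inj₂ τ∉j | inj₁ τ∈k = LoadBelow-sym (τ ∷ τs)
    (loadBelow-own τ τs (j≢k ∘ ≡.sym) τ∈k endsₖ λ endsₖ′ →
      LoadBelow-sym τs (loadBelow τs j≢k (endsInCompletion-other τ τs τ∉j endsⱼ) endsₖ′))
  ... | inj₂ τ∉j | inj₂ τ∉k = ⊎.map (skip τ∉j) (skip τ∉k)
    (loadBelow τs j≢k (endsInCompletion-other τ τs τ∉j endsⱼ) (endsInCompletion-other τ τs τ∉k endsₖ))
    where
    skip : ∀ {i} → job τ ≢ i → load (tasksFor i τs) ≤ pairWork j k τs →
           load (tasksFor i (τ ∷ τs)) ≤ pairWork j k (τ ∷ τs)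
    skip {i} τ∉i i≤ = begin
      load (tasksFor i (τ ∷ τs))  ≡⟨ load-other τ τs τ∉i ⟩
      load (tasksFor i τs)        ≤⟨ i≤ ⟩
      pairWork j k τs             ≈⟨ pairWork-skip τ τs τ∉j τ∉k ⟨
      pairWork j k (τ ∷ τs)       ∎

  module FeasibleSchedule {σ : Schedule n} (σ-feasible : Feasible I σ) where

    open Feasible σ-feasible

    endsInCompletion : ∀ j → EndsInCompletion j (tasksFor j (tasks σ))
    endsInCompletion j with eachJob j
    ... | inj₁ eq rewrite eq = last (completes-untested j) ≡.refl
      where
      completes-untested : ∀ i → completes i (untested i) ≡ true
      completes-untested i with inj₂ eq ← completes-own i (untested i) ≡.refl = eq
    ... | inj₂ eq rewrite eq = more ≡.refl (last (completes-exec j) ≡.refl)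
      where
      completes-exec : ∀ i → completes i (exec i) ≡ true
      completes-exec i with inj₂ eq ← completes-own i (exec i) ≡.refl = eq

    p*≤ : ∀ j {x} → load (tasksFor j (tasks σ)) ≤ x → p*[ j ]≤ x
    p*≤ j load≤ with eachJob j
    ... | inj₁ eq rewrite eq = inj₁ (≤-trans (x≤x+y ≤-refl) load≤)
    ... | inj₂ eq rewrite eq = inj₂ (≤-trans (+-monoʳ-≤ _ (x≤x+y ≤-refl)) load≤)

    p*≤work : ∀ j → p*[ j ]≤ work j j (tasks σ)
    p*≤work j = p*≤ j (load≤work (tasks σ) (endsInCompletion j))

    p*≤pairWork : ∀ {j k} → j ≢ k →
                  p*[ j ]≤ pairWork j k (tasks σ) ⊎ p*[ k ]≤ pairWork j k (tasks σ)
    p*≤pairWork {j} {k} j≢k = ⊎.map (p*≤ j) (p*≤ k)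
      (loadBelow (tasks σ) j≢k (endsInCompletion j) (endsInCompletion k))

    totalWork≤completionTime : ∀ j → totalWork j (tasks σ) ≤ completionTime I j σ
    totalWork≤completionTime j = ≤-trans (≤-reflexive (≈-sym (+-identityˡ _)))
      (completionTime-lower σ nonOverlapping (endsInCompletion j))

  -- Runs of the algorithm, seen through the queue entries of a pair.

  entriesOf : Fin n → Queue n → Queue n
  entriesOf j = filter (λ e → job (Entry.task e) ≟ j)

  -- Filtering respects permutations, and a permutation of a singleton is that singleton. So the
  -- extracted entry is either the only entry of `j` or an entry of another job.
  extract : ∀ {j e a} {q q′ : Queue n} → q ↭ e ∷ q′ → entriesOf j q ≡ a ∷ [] →
            (job (Entry.task e) ≡ j × e ≡ a × entriesOf j q′ ≡ [])
            ⊎ (job (Entry.task e) ≢ j × entriesOf j q′ ≡ a ∷ [])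
  extract {j} {e} {a} {q} {q′} q↭ eq with job (Entry.task e) ≟ j | only
    where
    only : entriesOf j (e ∷ q′) ≡ a ∷ []
    only = ↭-singleton-inv (≡.subst (entriesOf j (e ∷ q′) ↭_) eq
      (filter-↭ (λ e′ → job (Entry.task e′) ≟ j) (↭-sym q↭)))
  ... | yes e∈j | eq′ with ≡.refl , none ← ∷-injective eq′ = inj₁ (e∈j , ≡.refl , none)
  ... | no  e∉j | eq′  = inj₂ (e∉j , eq′)

  extract-absent : ∀ {j e} {q q′ : Queue n} → q ↭ e ∷ q′ → entriesOf j q ≡ [] →
                   job (Entry.task e) ≢ j × entriesOf j q′ ≡ []
  extract-absent {j} {e} {q} {q′} q↭ eq with job (Entry.task e) ≟ j | none
    where
    none : entriesOf j (e ∷ q′) ≡ []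
    none = ↭-empty-inv (≡.subst (entriesOf j (e ∷ q′) ↭_) eq
      (filter-↭ (λ e′ → job (Entry.task e′) ≟ j) (↭-sym q↭)))
  ... | no e∉j | eq′  = e∉j , eq′

  requeue-own : ∀ {j} (τ : Task n) {q′} → job τ ≡ j → entriesOf j q′ ≡ [] →
                entriesOf j (insertedAfter I τ ++ q′) ≡ insertedAfter I τ
  requeue-own (test j) ≡.refl none with j ≟ j
  ... | yes _   = ≡.cong (_ ∷_) none
  ... | no  j≢j = contradiction ≡.refl j≢j
  requeue-own (exec j)     ≡.refl none = none
  requeue-own (untested j) ≡.refl none = none

  requeue-other : ∀ {j} (τ : Task n) {q′ q″} → job τ ≢ j → entriesOf j q′ ≡ q″ →
                  entriesOf j (insertedAfter I τ ++ q′) ≡ q″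
  requeue-other {j} (test i) τ∉j eq with i ≟ j
  ... | yes τ∈j = contradiction τ∈j τ∉j
  ... | no  _   = eq
  requeue-other (exec i)     τ∉j eq = eq
  requeue-other (untested i) τ∉j eq = eq

  completes⇒nothing-inserted : ∀ {j} (τ : Task n) → completes j τ ≡ true → insertedAfter I τ ≡ []
  completes⇒nothing-inserted (exec i)     eq = ≡.refl
  completes⇒nothing-inserted (untested i) eq = ≡.refl

  -- Only the extraction of an entry of `j` can insert a task of `j`, so a job without an entry
  -- never returns to the queue.
  work-absent : ∀ {j k now q σ} → Run I now q σ → entriesOf j q ≡ [] → work j k (tasks σ) ≈ 0#
  work-absent done none = ≈-refl
  work-absent {j} {k} (step {τ = τ} {σ = σ} q↭ minimal run) none with extract-absent q↭ none
  ... | τ∉j , none′ with work-absent {j} {k} run (requeue-other τ τ∉j none′) | completes? k τ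
  ...   | ih | inj₁ eq rewrite eq | workOn-other {j} {τ} τ∉j = +-identityˡ 0#
  ...   | ih | inj₂ eq = ≈-trans (work-skip τ (tasks σ) τ∉j eq) ih

  -- A run starts each task when the previous one ends, so there is no idle time to account for. The
  -- hypothesis `0# ≤ now` serves the end of the run, where the completion time defaults to `0#`.
  completionTime-upper : ∀ {j now q σ} → Run I now q σ → 0# ≤ now →
                         completionTime I j σ ≤ now + totalWork j (tasks σ)
  completionTime-upper {j} {now} done 0≤now = ≤-trans 0≤now
    (x≤x+y (≤-reflexive (≈-sym (Sum.sum-replicate-zero +-commutativeMonoid n))))
  completionTime-upper {j} {now} (step {τ = τ} {σ = σ} q↭ minimal run) 0≤now with completes? j τ
  ... | inj₁ eq = begin
    completionTime I j (τ at now ∷ σ)    ≡⟨ completionTime-last (τ at now) σ eq ⟩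
    now + duration I τ                   ≈⟨ +-congˡ (totalWork-last τ (tasks σ) eq) ⟨
    now + totalWork j (τ ∷ tasks σ)      ∎
  ... | inj₂ eq = begin
    completionTime I j (τ at now ∷ σ)              ≡⟨ completionTime-step (τ at now) σ eq ⟩
    completionTime I j σ                           ≤⟨ completionTime-upper run (+-nonNeg 0≤now (duration-nonNeg τ)) ⟩
    now + duration I τ + totalWork j (tasks σ)     ≈⟨ +-assoc _ _ _ ⟩
    now + (duration I τ + totalWork j (tasks σ))   ≈⟨ +-congˡ (totalWork-step τ (tasks σ) eq) ⟨
    now + totalWork j (τ ∷ tasks σ)                ∎

  -- The work still to be done on a job whose queue entry holds this task: a test will be followed
  -- by its execution.
  processing : Task n → Carrier
  processing (test j)     = t j + p j
  processing (exec j)     = p j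
  processing (untested j) = u j

  work-processing : ∀ {j now q σ a} → Run I now q σ → entriesOf j q ≡ a ∷ [] →
                    work j j (tasks σ) ≈ processing (Entry.task a)
  work-processing {j} (step {τ = τ} {σ = σ} q↭ minimal run) eq with extract q↭ eq
  ... | inj₂ (τ∉j , eq′) = ≈-trans (work-skip τ (tasks σ) τ∉j (completes-other τ τ∉j))
                                   (work-processing run (requeue-other τ τ∉j eq′))
  ... | inj₁ (τ∈j , ≡.refl , none) with completes-own j τ τ∈j
  ...   | inj₁ ≡.refl = ≈-trans (work-own τ (tasks σ) ≡.refl ≡.refl)
                                (+-congˡ (work-processing run (requeue-own τ τ∈j none)))
  ...   | inj₂ eq′ = ≈-trans (work-last τ (tasks σ) eq′) (finalDuration τ eq′)
    where
    finalDuration : ∀ (τ : Task n) → completes j τ ≡ true → duration I τ ≈ processing τ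
    finalDuration (exec i)     _ = ≈-refl
    finalDuration (untested i) _ = ≈-refl

  -- However the algorithm continues from a queue in which a and b are the
  -- entries of the jobs j and k, the total of x and the work still charged to
  -- the pair {j, k} is at most y.
  PairBound : Fin n → Fin n → Entry n → Entry n → Carrier → Carrier → Set (c ⊔ ℓ₂)
  PairBound j k a b x y =
    ∀ {now q σ} → Run I now q σ → entriesOf j q ≡ a ∷ [] → entriesOf k q ≡ b ∷ [] →
    x + pairWork j k (tasks σ) ≤ y

  -- The same when the entry a is extracted before b.
  data BoundAfter (j k : Fin n) (a b : Entry n) (x y : Carrier) : Set (c ⊔ ℓ₂) where
    completed : completes j (Entry.task a) ≡ true →
                x + duration I (Entry.task a) ≤ y → BoundAfter j k a b x y
    tested    : Entry.task a ≡ test j →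
                PairBound j k (exec j weighing (t j + p j)) b (x + t j) y → BoundAfter j k a b x y

  -- Here `q` is the queue left by the extraction of `a`. A completing task closes the account of
  -- the pair, since no entry of `j` remains; a test moves its duration into the accumulated charge
  -- `x` and replaces the entry by an execution.
  boundAfter : ∀ {j k a b x y now q σ} → j ≢ k → BoundAfter j k a b x y →
               job (Entry.task a) ≡ j → entriesOf j q ≡ [] → entriesOf k q ≡ b ∷ [] →
               Run I now (insertedAfter I (Entry.task a) ++ q) σ →
               x + pairWork j k (Entry.task a ∷ tasks σ) ≤ y
  boundAfter {j} {k} {τ weighing _} {b} {x} {y} {σ = σ} j≢k (completed eq x+d≤y) τ∈j none only run = begin
    x + pairWork j k (τ ∷ tasks σ)                 ≈⟨ +-congˡ (pairWork-last τ (tasks σ) j≢k eq) ⟩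
    x + (duration I τ + work j k (tasks σ))        ≈⟨ +-congˡ (+-congˡ (work-absent run none′)) ⟩
    x + (duration I τ + 0#)                        ≈⟨ +-congˡ (+-identityʳ _) ⟩
    x + duration I τ                               ≤⟨ x+d≤y ⟩
    y                                              ∎
    where
    none′ = ≡.trans (requeue-own τ τ∈j none) (completes⇒nothing-inserted τ eq)
  boundAfter {j} {k} {τ weighing _} {b} {x} {y} {σ = σ} j≢k (tested ≡.refl bound) τ∈j none only run = begin
    x + pairWork j k (τ ∷ tasks σ)                 ≈⟨ +-congˡ (pairWork-own τ (tasks σ) j≢k τ∈j ≡.refl) ⟩
    x + (t j + pairWork j k (tasks σ))             ≈⟨ +-assoc _ _ _ ⟨
    x + t j + pairWork j k (tasks σ)               ≤⟨ bound run (requeue-own τ τ∈j none) (requeue-other τ j≢k only) ⟩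
    y                                              ∎

  lightest : ∀ {k w b} {q : Queue n} → All (λ e → w ≤ Entry.weight e) q →
             entriesOf k q ≡ b ∷ [] → w ≤ Entry.weight b
  lightest {k} minimal only with filter⁺ (λ e → job (Entry.task e) ≟ k) minimal
  ... | minimal′ rewrite only = All.head minimal′

  -- Extractions of other jobs change neither the two entries nor the charge. The first extraction
  -- that concerns the pair takes an entry of minimal weight, which yields the comparison. Iterated,
  -- this reduces a run to a finite decision tree for the pair.
  pairBound : ∀ {j k a b x y} → j ≢ k →
              (Entry.weight a ≤ Entry.weight b → BoundAfter j k a b x y) →
              (Entry.weight b ≤ Entry.weight a → BoundAfter k j b a x y) →
              PairBound j k a b x y
  pairBound {j} {k} {a} {b} {x} {y} j≢k aFirst bFirst (step {τ = τ} {σ = σ} q↭ minimal run) onlyⱼ onlyₖ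
    with extract q↭ onlyⱼ | extract q↭ onlyₖ
  ... | inj₁ (τ∈j , _ , _) | inj₁ (τ∈k , _ , _) = contradiction (≡.trans (≡.sym τ∈j) τ∈k) j≢k
  ... | inj₁ (τ∈j , ≡.refl , none) | inj₂ (_ , onlyₖ′) =
    boundAfter j≢k (aFirst (lightest minimal onlyₖ′)) τ∈j none onlyₖ′ run
  ... | inj₂ (_ , onlyⱼ′) | inj₁ (τ∈k , ≡.refl , none) =
    ≤-trans (≤-reflexive (+-congˡ (pairWork-comm j k (τ ∷ tasks σ))))
      (boundAfter (j≢k ∘ ≡.sym) (bFirst (lightest minimal onlyⱼ′)) τ∈k none onlyⱼ′ run)
  ... | inj₂ (τ∉j , onlyⱼ′) | inj₂ (τ∉k , onlyₖ′) =
    ≤-trans (≤-reflexive (+-congˡ (pairWork-skip τ (tasks σ) τ∉j τ∉k)))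
      (pairBound j≢k aFirst bFirst run (requeue-other τ τ∉j onlyⱼ′) (requeue-other τ τ∉k onlyₖ′))

-- The terms of the ratio.

module PCPAnalysis {c ℓ₁ ℓ₂} (F : OrderedField c ℓ₁ ℓ₂)
                   (α β : OrderedField.Carrier F)
                   (1≤α : OrderedField._≤_ F (OrderedField.1# F) α)
                   (1≤β : OrderedField._≤_ F (OrderedField.1# F) β) where

  open OrderedField F
  open OrderedFieldProperties F
  open Scheduling F
  open Max totalOrder using (x≤x⊔y; x≤y⊔x)

  -- The maxima are nested as in the theorem, so that `ratio` unfolds to the bound stated there.
  ratio₅ ratio₄ ratio₃ ratio₂ ratio : Carrier
  ratio₅ = 1# + 2# ÷ α
  ratio₄ = max 2# ratio₅
  ratio₃ = max β ratio₄
  ratio₂ = max (1# + 1# ÷ α + 1# ÷ β + 1# ÷ (α * β)) ratio₃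
  ratio  = max (α * (1# + 1# ÷ β)) ratio₂

  ratio₃≤ratio : ratio₃ ≤ ratio
  ratio₃≤ratio = ≤-trans (x≤y⊔x _ _) (x≤y⊔x _ ratio₂)

  ratio₄≤ratio : ratio₄ ≤ ratio
  ratio₄≤ratio = ≤-trans (x≤y⊔x β ratio₄) ratio₃≤ratio

  0≤α⁻¹ : 0# ≤ α ⁻¹
  0≤α⁻¹ = 0≤x⁻¹ 1≤α

  0≤β⁻¹ : 0# ≤ β ⁻¹
  0≤β⁻¹ = 0≤x⁻¹ 1≤β

  module _ {x : Carrier} (0≤x : 0# ≤ x) where

    2x≤ratio : x + x ≤ ratio * x
    2x≤ratio = begin
      x + x      ≈⟨ solve 1 (λ x → x :+ x := con 2 :* x) ≈-refl x ⟩
      2# * x     ≤⟨ *-monoʳ-≤-nonNeg 0≤x (≤-trans (x≤x⊔y 2# ratio₅) ratio₄≤ratio) ⟩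
      ratio * x  ∎

    x+2α⁻¹x≤ratio : x + (α ⁻¹ * x + α ⁻¹ * x) ≤ ratio * x
    x+2α⁻¹x≤ratio = begin
      x + (α ⁻¹ * x + α ⁻¹ * x) ≈⟨ solve 2 (λ x a → x :+ (a :* x :+ a :* x) := (con 1 :+ con 2 :* a) :* x) ≈-refl x (α ⁻¹) ⟩
      ratio₅ * x                ≤⟨ *-monoʳ-≤-nonNeg 0≤x (≤-trans (x≤y⊔x 2# ratio₅) ratio₄≤ratio) ⟩
      ratio * x                 ∎

    βx≤ratio : β * x ≤ ratio * x
    βx≤ratio = *-monoʳ-≤-nonNeg 0≤x (≤-trans (x≤x⊔y β ratio₄) ratio₃≤ratio)

    -- Meant for `y` the length of an untested job; `β ⁻¹ * y` then bounds a test that was extracted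
    -- before it.
    [1+β⁻¹]αx≤ratio : ∀ {y} → y ≤ α * x → y + β ⁻¹ * y ≤ ratio * x
    [1+β⁻¹]αx≤ratio {y} y≤αx = begin
      y + β ⁻¹ * y                    ≤⟨ +-mono-≤ y≤αx (*-monoˡ-≤-nonNeg 0≤β⁻¹ y≤αx) ⟩
      α * x + β ⁻¹ * (α * x)          ≈⟨ solve 3 (λ x a b → a :* x :+ b :* (a :* x) := a :* (con 1 :+ con 1 :* b) :* x) ≈-refl x α (β ⁻¹) ⟩
      α * (1# + 1# ÷ β) * x           ≤⟨ *-monoʳ-≤-nonNeg 0≤x (x≤x⊔y _ ratio₂) ⟩
      ratio * x                       ∎

    -- Meant for `y` the testing plus execution time of a tested job; `β ⁻¹ * y` then bounds the
    -- test of another job run before that execution.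
    [1+β⁻¹][1+α⁻¹]x≤ratio : ∀ {y} → y ≤ x + α ⁻¹ * x → y + β ⁻¹ * y ≤ ratio * x
    [1+β⁻¹][1+α⁻¹]x≤ratio {y} y≤ = begin
      y + β ⁻¹ * y                                       ≤⟨ +-mono-≤ y≤ (*-monoˡ-≤-nonNeg 0≤β⁻¹ y≤) ⟩
      x + α ⁻¹ * x + β ⁻¹ * (x + α ⁻¹ * x)               ≈⟨ solve 3 (λ x a b → x :+ a :* x :+ b :* (x :+ a :* x) := (con 1 :+ con 1 :* a :+ con 1 :* b :+ con 1 :* (a :* b)) :* x) ≈-refl x (α ⁻¹) (β ⁻¹) ⟩
      (1# + 1# ÷ α + 1# ÷ β + 1# * (α ⁻¹ * β ⁻¹)) * x    ≈⟨ *-congʳ (+-congˡ (*-congˡ (⁻¹-distrib-* 1≤α 1≤β))) ⟨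
      (1# + 1# ÷ α + 1# ÷ β + 1# ÷ (α * β)) * x          ≤⟨ *-monoʳ-≤-nonNeg 0≤x (≤-trans (x≤x⊔y _ ratio₃) (x≤y⊔x _ ratio₂)) ⟩
      ratio * x                                          ∎

    -- `α` is not itself a term of the maximum, but `α * (1# + 1# ÷ β)` dominates it.
    αx≤ratio : ∀ {y} → y ≤ α * x → y ≤ ratio * x
    αx≤ratio y≤αx = ≤-trans y≤αx (≤-trans
      (x≤x+y (*-nonNeg 0≤β⁻¹ (*-nonNeg (1≤x⇒0≤x 1≤α) 0≤x))) ([1+β⁻¹]αx≤ratio ≤-refl))

    [1+α⁻¹]x≤ratio : ∀ {y} → y ≤ x + α ⁻¹ * x → y ≤ ratio * x
    [1+α⁻¹]x≤ratio y≤ = ≤-trans y≤ (≤-trans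
      (x≤x+y (*-nonNeg 0≤β⁻¹ (+-nonNeg 0≤x (*-nonNeg 0≤α⁻¹ 0≤x)))) ([1+β⁻¹][1+α⁻¹]x≤ratio ≤-refl))

  -- Time spent on one job against its optimal processing time.

  module _ {n : ℕ} (I : Instance n) where

    open Instance I
    open PairwiseWork F I

    module _ {j : Fin n} {x : Carrier} (αt≤u : α * t j ≤ u j) where

      t≤α⁻¹u : t j ≤ α ⁻¹ * u j
      t≤α⁻¹u = x*y≤z⇒y≤x⁻¹*z 1≤α αt≤u

      t≤p* : p*[ j ]≤ x → t j ≤ x
      t≤p* p*≤x with p*≤x
      ... | inj₁ u≤x   = ≤-trans (1≤x⇒y≤x*y 1≤α (t≥0 j)) (≤-trans αt≤u u≤x)
      ... | inj₂ t+p≤x = ≤-trans (x≤x+y (p≥0 j)) t+p≤x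

      -- Testing loses something only against `u j ≤ x`. Then `p j ≤ x`, and the testing rule bounds
      -- the test by `α ⁻¹ * x`.
      t+p≤[1+α⁻¹]p* : p*[ j ]≤ x → t j + p j ≤ x + α ⁻¹ * x
      t+p≤[1+α⁻¹]p* p*≤x with p*≤x
      ... | inj₁ u≤x   = begin
        t j + p j     ≤⟨ +-mono-≤ (≤-trans t≤α⁻¹u (*-monoˡ-≤-nonNeg 0≤α⁻¹ u≤x)) (≤-trans (p≤u j) u≤x) ⟩
        α ⁻¹ * x + x  ≈⟨ +-comm _ _ ⟩
        x + α ⁻¹ * x  ∎
      ... | inj₂ t+p≤x = ≤-trans t+p≤x (x≤x+y (*-nonNeg 0≤α⁻¹ (p*-nonNeg {j} p*≤x)))

      -- The source of the terms `1# + 2# ÷ α` and `2#`, for `u j ≤ x` and `t j + p j ≤ x`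
      -- respectively. The extra `t j` makes room for a second task charged to the pair.
      2t+p≤ratio : p*[ j ]≤ x → t j + (t j + p j) ≤ ratio * x
      2t+p≤ratio p*≤x with p*≤x
      ... | inj₁ u≤x   = begin
        t j + (t j + p j)          ≤⟨ +-mono-≤ t≤α⁻¹x (+-mono-≤ t≤α⁻¹x (≤-trans (p≤u j) u≤x)) ⟩
        α ⁻¹ * x + (α ⁻¹ * x + x)  ≈⟨ solve 2 (λ a x → a :+ (a :+ x) := x :+ (a :+ a)) ≈-refl (α ⁻¹ * x) x ⟩
        x + (α ⁻¹ * x + α ⁻¹ * x)  ≤⟨ x+2α⁻¹x≤ratio (p*-nonNeg {j} p*≤x) ⟩
        ratio * x                  ∎
        where
        t≤α⁻¹x : t j ≤ α ⁻¹ * x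
        t≤α⁻¹x = ≤-trans t≤α⁻¹u (*-monoˡ-≤-nonNeg 0≤α⁻¹ u≤x)
      ... | inj₂ t+p≤x = ≤-trans (+-mono-≤ (≤-trans (x≤x+y (p≥0 j)) t+p≤x) t+p≤x)
                                 (2x≤ratio (p*-nonNeg {j} p*≤x))

    u≤αp* : ∀ {j x} → u j ≤ α * t j → p*[ j ]≤ x → u j ≤ α * x
    u≤αp* {j} u≤αt (inj₁ u≤x)   = ≤-trans u≤x (1≤x⇒y≤x*y 1≤α (≤-trans (u≥0 j) u≤x))
    u≤αp* {j} u≤αt (inj₂ t+p≤x) =
      ≤-trans u≤αt (*-monoˡ-≤-nonNeg (1≤x⇒0≤x 1≤α) (≤-trans (x≤x+y (p≥0 j)) t+p≤x))

    initialEntry-cases : ∀ j → (α * t j ≤ u j × initialEntry I α β j ≡ test j weighing (β * t j))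
                             ⊎ (u j ≤ α * t j × initialEntry I α β j ≡ untested j weighing u j)
    initialEntry-cases j with α * t j ≤? u j
    ... | yes αt≤u = inj₁ (αt≤u , ≡.refl)
    ... | no  αt≰u with total (α * t j) (u j)
    ...   | inj₁ αt≤u = contradiction αt≤u αt≰u
    ...   | inj₂ u≤αt = inj₂ (u≤αt , ≡.refl)

    extractCompleting : ∀ {j k w b x y} τ → job τ ≡ j → (∀ i → τ ≢ test i) → x + duration I τ ≤ y →
                 BoundAfter j k (τ weighing w) b x y
    extractCompleting {j} τ τ∈j ¬test x+d≤y with completes-own j τ τ∈j
    ... | inj₁ τ≡test = contradiction τ≡test (¬test j)
    ... | inj₂ eq     = completed eq x+d≤y

    extractExec : ∀ {j k w b x y} → x + p j ≤ y → BoundAfter j k (exec j weighing w) b x y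
    extractExec {j} = extractCompleting (exec j) ≡.refl λ _ ()

    extractUntested : ∀ {j k w b x y} → x + u j ≤ y → BoundAfter j k (untested j weighing w) b x y
    extractUntested {j} = extractCompleting (untested j) ≡.refl λ _ ()

    -- Case analysis for a pair of distinct jobs.

    module _ {j k : Fin n} {x : Carrier} (j≢k : j ≢ k) (p*≤x : p*[ j ]≤ x) where

      0≤x : 0# ≤ x
      0≤x = p*-nonNeg {j} p*≤x

      -- Only `j` is compared with `x`, here and in the other cases; `k` is controlled through the
      -- weights. Here it goes first only if `u k ≤ u j`.
      bothUntested : u j ≤ α * t j →
                     PairBound j k (untested j weighing u j) (untested k weighing u k) 0# (ratio * x)
      bothUntested u≤αt = pairBound j≢k
        (λ _ → extractUntested (≤-trans (≤-reflexive (+-identityˡ _)) uⱼ≤))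
        (λ uₖ≤uⱼ → extractUntested (≤-trans (≤-reflexive (+-identityˡ _)) (≤-trans uₖ≤uⱼ uⱼ≤)))
        where
        uⱼ≤ : u j ≤ ratio * x
        uⱼ≤ = αx≤ratio 0≤x (u≤αp* u≤αt p*≤x)

      -- The term `β` enters when `k` precedes the test of `j`, which requires `u k ≤ β * t j`.
      -- After that test, `k` precedes the execution of `j` only if `u k ≤ t j + p j`.
      onlySecondUntested : α * t j ≤ u j →
                           PairBound j k (test j weighing (β * t j)) (untested k weighing u k) 0# (ratio * x)
      onlySecondUntested αt≤u = pairBound j≢k
        (λ _ → tested ≡.refl (pairBound j≢k
          (λ _ → extractExec (begin
            0# + t j + p j      ≈⟨ +-congʳ (+-identityˡ _) ⟩
            t j + p j           ≤⟨ [1+α⁻¹]x≤ratio 0≤x (t+p≤[1+α⁻¹]p* αt≤u p*≤x) ⟩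
            ratio * x           ∎))
          (λ uₖ≤t+p → extractUntested (begin
            0# + t j + u k      ≈⟨ +-congʳ (+-identityˡ _) ⟩
            t j + u k           ≤⟨ +-monoʳ-≤ _ uₖ≤t+p ⟩
            t j + (t j + p j)   ≤⟨ 2t+p≤ratio αt≤u p*≤x ⟩
            ratio * x           ∎))))
        (λ uₖ≤βt → extractUntested (begin
          0# + u k    ≈⟨ +-identityˡ _ ⟩
          u k         ≤⟨ uₖ≤βt ⟩
          β * t j     ≤⟨ *-monoˡ-≤-nonNeg (1≤x⇒0≤x 1≤β) (t≤p* αt≤u p*≤x) ⟩
          β * x       ≤⟨ βx≤ratio 0≤x ⟩
          ratio * x   ∎))

      -- The term `α * (1# + 1# ÷ β)` comes from the order test of `k`, then `j`: the test goes
      -- first only if `β * t k ≤ u j`, and `u j` is at most `α * x`.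
      onlyFirstUntested : u j ≤ α * t j →
                          PairBound j k (untested j weighing u j) (test k weighing (β * t k)) 0# (ratio * x)
      onlyFirstUntested u≤αt = pairBound j≢k
        (λ _ → extractUntested (begin
          0# + u j    ≈⟨ +-identityˡ _ ⟩
          u j         ≤⟨ αx≤ratio 0≤x uⱼ≤αx ⟩
          ratio * x   ∎))
        (λ βt≤uⱼ → tested ≡.refl (pairBound (j≢k ∘ ≡.sym)
          (λ t+p≤uⱼ → extractExec (begin
            0# + t k + p k   ≈⟨ +-congʳ (+-identityˡ _) ⟩
            t k + p k        ≤⟨ t+p≤uⱼ ⟩
            u j              ≤⟨ αx≤ratio 0≤x uⱼ≤αx ⟩
            ratio * x        ∎))
          (λ _ → extractUntested (begin
            0# + t k + u j     ≈⟨ +-congʳ (+-identityˡ _) ⟩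
            t k + u j          ≤⟨ +-monoˡ-≤ _ (x*y≤z⇒y≤x⁻¹*z 1≤β βt≤uⱼ) ⟩
            β ⁻¹ * u j + u j   ≈⟨ +-comm _ _ ⟩
            u j + β ⁻¹ * u j   ≤⟨ [1+β⁻¹]αx≤ratio 0≤x uⱼ≤αx ⟩
            ratio * x          ∎))))
        where
        uⱼ≤αx : u j ≤ α * x
        uⱼ≤αx = u≤αp* u≤αt p*≤x

      -- The charge ends with the first execution, which leaves six orders. Test `j`, test `k`,
      -- execute `j` gives the product of `1# + 1# ÷ α` and `1# + 1# ÷ β`; test `k`, execute `k`
      -- gives `β`. The other three orders with both tests reduce to `2t+p≤ratio`.
      bothTested : α * t j ≤ u j →
                   PairBound j k (test j weighing (β * t j)) (test k weighing (β * t k)) 0# (ratio * x)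
      bothTested αt≤u = pairBound j≢k
        (λ βtⱼ≤βtₖ → tested ≡.refl (pairBound j≢k
          (λ _ → extractExec (begin
            0# + t j + p j      ≈⟨ +-congʳ (+-identityˡ _) ⟩
            t j + p j           ≤⟨ [1+α⁻¹]x≤ratio 0≤x t+p≤ ⟩
            ratio * x           ∎))
          (λ βtₖ≤t+pⱼ → tested ≡.refl (pairBound (j≢k ∘ ≡.sym)
            (λ t+pₖ≤t+pⱼ → extractExec (begin
              0# + t j + t k + p k   ≈⟨ solve 3 (λ a b c → con 0 :+ a :+ b :+ c := a :+ (b :+ c)) ≈-refl (t j) (t k) (p k) ⟩
              t j + (t k + p k)      ≤⟨ +-monoʳ-≤ _ t+pₖ≤t+pⱼ ⟩
              t j + (t j + p j)      ≤⟨ 2t+p≤ratio αt≤u p*≤x ⟩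
              ratio * x              ∎))
            (λ _ → extractExec (begin
              0# + t j + t k + p j           ≈⟨ solve 3 (λ a b c → con 0 :+ a :+ b :+ c := a :+ c :+ b) ≈-refl (t j) (t k) (p j) ⟩
              t j + p j + t k                ≤⟨ +-monoʳ-≤ _ (x*y≤z⇒y≤x⁻¹*z 1≤β βtₖ≤t+pⱼ) ⟩
              t j + p j + β ⁻¹ * (t j + p j) ≤⟨ [1+β⁻¹][1+α⁻¹]x≤ratio 0≤x t+p≤ ⟩
              ratio * x                      ∎))))))
        (λ βtₖ≤βtⱼ → tested ≡.refl (pairBound (j≢k ∘ ≡.sym)
          (λ t+pₖ≤βtⱼ → extractExec (begin
            0# + t k + p k   ≈⟨ +-congʳ (+-identityˡ _) ⟩
            t k + p k        ≤⟨ t+pₖ≤βtⱼ ⟩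
            β * t j          ≤⟨ *-monoˡ-≤-nonNeg (1≤x⇒0≤x 1≤β) (t≤p* αt≤u p*≤x) ⟩
            β * x            ≤⟨ βx≤ratio 0≤x ⟩
            ratio * x        ∎))
          (λ _ → tested ≡.refl (pairBound j≢k
            (λ _ → extractExec (begin
              0# + t k + t j + p j   ≈⟨ solve 3 (λ a b c → con 0 :+ a :+ b :+ c := a :+ (b :+ c)) ≈-refl (t k) (t j) (p j) ⟩
              -- The test of `k` was extracted before that of `j`. Both weights carry the factor
              -- `β`, which cancels to `t k ≤ t j`.
              t k + (t j + p j)      ≤⟨ +-monoˡ-≤ _ (1≤x⇒*-cancelˡ-≤ 1≤β βtₖ≤βtⱼ) ⟩
              t j + (t j + p j)      ≤⟨ 2t+p≤ratio αt≤u p*≤x ⟩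
              ratio * x              ∎))
            (λ t+pₖ≤t+pⱼ → extractExec (begin
              0# + t k + t j + p k   ≈⟨ solve 3 (λ a b c → con 0 :+ a :+ b :+ c := b :+ (a :+ c)) ≈-refl (t k) (t j) (p k) ⟩
              t j + (t k + p k)      ≤⟨ +-monoʳ-≤ _ t+pₖ≤t+pⱼ ⟩
              t j + (t j + p j)      ≤⟨ 2t+p≤ratio αt≤u p*≤x ⟩
              ratio * x              ∎))))))
        where
        t+p≤ : t j + p j ≤ x + α ⁻¹ * x
        t+p≤ = t+p≤[1+α⁻¹]p* αt≤u p*≤x

      initialPairBound : PairBound j k (initialEntry I α β j) (initialEntry I α β k) 0# (ratio * x)
      initialPairBound with initialEntry-cases j | initialEntry-cases k
      ... | inj₁ (αt≤u , eqⱼ) | inj₁ (_ , eqₖ) rewrite eqⱼ | eqₖ = bothTested αt≤u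
      ... | inj₁ (αt≤u , eqⱼ) | inj₂ (_ , eqₖ) rewrite eqⱼ | eqₖ = onlySecondUntested αt≤u
      ... | inj₂ (u≤αt , eqⱼ) | inj₁ (_ , eqₖ) rewrite eqⱼ | eqₖ = onlyFirstUntested u≤αt
      ... | inj₂ (u≤αt , eqⱼ) | inj₂ (_ , eqₖ) rewrite eqⱼ | eqₖ = bothUntested u≤αt

    -- Single jobs and the initial queue.

    initialProcessing : ∀ {j x} → p*[ j ]≤ x →
                        processing (Entry.task (initialEntry I α β j)) ≤ ratio * x
    initialProcessing {j} p*≤x with initialEntry-cases j
    ... | inj₁ (αt≤u , eq) rewrite eq = [1+α⁻¹]x≤ratio (p*-nonNeg {j} p*≤x) (t+p≤[1+α⁻¹]p* αt≤u p*≤x)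
    ... | inj₂ (u≤αt , eq) rewrite eq = αx≤ratio (p*-nonNeg {j} p*≤x) (u≤αp* u≤αt p*≤x)

    job-initialEntry : ∀ j → job (Entry.task (initialEntry I α β j)) ≡ j
    job-initialEntry j with initialEntry-cases j
    ... | inj₁ (_ , eq) rewrite eq = ≡.refl
    ... | inj₂ (_ , eq) rewrite eq = ≡.refl

    entriesOf-initial-absent : ∀ {j is} → All (j ≢_) is →
                               entriesOf j (map (initialEntry I α β) is) ≡ []
    entriesOf-initial-absent [] = ≡.refl
    entriesOf-initial-absent {j} {i ∷ is} (j≢i ∷ absent) = ≡.trans
      (filter-reject (λ e → job (Entry.task e) ≟ j)
        {x = initialEntry I α β i} {xs = map (initialEntry I α β) is}
        (λ eq → j≢i (≡.trans (≡.sym eq) (job-initialEntry i))))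
      (entriesOf-initial-absent absent)

    -- Stated for an arbitrary list without repetitions so that induction applies; the case of
    -- interest is `allFin n`.
    entriesOf-initial : ∀ {j is} → Unique is → j ∈ is →
                        entriesOf j (map (initialEntry I α β) is) ≡ initialEntry I α β j ∷ []
    entriesOf-initial {j} {_ ∷ is} (absent ∷ _) (here ≡.refl) = ≡.trans
      (filter-accept (λ e → job (Entry.task e) ≟ j)
        {x = initialEntry I α β j} {xs = map (initialEntry I α β) is} (job-initialEntry j))
      (≡.cong (_ ∷_) (entriesOf-initial-absent absent))
    entriesOf-initial {j} {i ∷ is} (absent ∷ unique) (there j∈is) = ≡.trans
      (filter-reject (λ e → job (Entry.task e) ≟ j)
        {x = initialEntry I α β i} {xs = map (initialEntry I α β) is}
        (λ eq → All.lookup absent j∈is (≡.trans (≡.sym (job-initialEntry i)) eq)))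
      (entriesOf-initial unique j∈is)

    entriesOf-initialQueue : ∀ j → entriesOf j (initialQueue I α β) ≡ initialEntry I α β j ∷ []
    entriesOf-initialQueue j = entriesOf-initial (allFin⁺ n) (∈-allFin j)

    -- Summation over all ordered pairs.

    module _ {σ opt : Schedule n} (run : PCP α β I σ) (opt-feasible : Feasible I opt) where

      open FeasibleSchedule opt-feasible

      A O : Fin n → Fin n → Carrier
      A k j = work k j (tasks σ)
      O k j = work k j (tasks opt)

      ownWork≤ : ∀ j → A j j ≤ ratio * O j j
      ownWork≤ j = ≤-trans
        (≤-reflexive (work-processing run (entriesOf-initialQueue j)))
        (initialProcessing (p*≤work j))

      pairWork≤ : ∀ j k → A j k + A k j ≤ ratio * (O j k + O k j)
      pairWork≤ j k with j ≟ k
      ... | yes ≡.refl = ≤-trans (+-mono-≤ (ownWork≤ j) (ownWork≤ j)) (≤-reflexive (≈-sym (distribˡ _ _ _)))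
      -- The work of the pair in `opt` is the `x` of the case analysis. It is an upper bound for the
      -- optimal processing time of one of the two jobs, and that job takes the role of `j` there.
      ... | no j≢k with p*≤pairWork j≢k
      ...   | inj₁ p*ⱼ≤ = ≤-trans (≤-reflexive (≈-sym (+-identityˡ _)))
        (initialPairBound j≢k p*ⱼ≤ run (entriesOf-initialQueue j) (entriesOf-initialQueue k))
      ...   | inj₂ p*ₖ≤ = begin
        A j k + A k j            ≈⟨ +-comm _ _ ⟩
        A k j + A j k            ≈⟨ +-identityˡ _ ⟨
        0# + (A k j + A j k)     ≤⟨ initialPairBound (j≢k ∘ ≡.sym) p*ₖ≤ run (entriesOf-initialQueue k) (entriesOf-initialQueue j) ⟩
        ratio * (O j k + O k j)  ∎

      doubleSum : (Fin n → Fin n → Carrier) → Carrier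
      doubleSum f = sum (λ j → sum (λ k → f k j))

      -- Exchanging the order of summation in one copy matches the summand for `(j, k)` with the one
      -- for `(k, j)`.
      doubleSum-symmetrise : ∀ f → doubleSum f + doubleSum f ≈ sum (λ j → sum (λ k → f j k + f k j))
      doubleSum-symmetrise f = begin-equality
        doubleSum f + doubleSum f ≈⟨ +-congʳ (Sum.∑-comm +-commutativeMonoid (λ j k → f k j)) ⟩
        sum (λ j → sum (λ k → f j k)) + doubleSum f ≈⟨ Sum.∑-distrib-+ +-commutativeMonoid (λ j → sum (λ k → f j k)) (λ j → sum (λ k → f k j)) ⟨
        sum (λ j → sum (λ k → f j k) + sum (λ k → f k j)) ≈⟨ Sum.sum-cong-≋ +-commutativeMonoid (λ j → Sum.∑-distrib-+ +-commutativeMonoid (λ k → f j k) (λ k → f k j)) ⟨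
        sum (λ j → sum (λ k → f j k + f k j)) ∎

      doubleSum≤ : doubleSum A ≤ ratio * doubleSum O
      doubleSum≤ = double-cancel-≤ (begin
        doubleSum A + doubleSum A                                 ≈⟨ doubleSum-symmetrise A ⟩
        sum (λ j → sum (λ k → A j k + A k j))                     ≤⟨ sum-mono-≤ (λ j → sum-mono-≤ (pairWork≤ j)) ⟩
        sum (λ j → sum (λ k → ratio * (O j k + O k j)))           ≈⟨ Sum.sum-cong-≋ +-commutativeMonoid (λ j → SemiringSum.*-distribˡ-sum semiring ratio (λ k → O j k + O k j)) ⟨
        sum (λ j → ratio * sum (λ k → O j k + O k j))             ≈⟨ SemiringSum.*-distribˡ-sum semiring ratio (λ j → sum (λ k → O j k + O k j)) ⟨
        ratio * sum (λ j → sum (λ k → O j k + O k j))             ≈⟨ *-congˡ (doubleSum-symmetrise O) ⟨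
        ratio * (doubleSum O + doubleSum O)                       ≈⟨ distribˡ _ _ _ ⟩
        ratio * doubleSum O + ratio * doubleSum O                 ∎)

      cost≤ratio*cost : cost I σ ≤ ratio * cost I opt
      cost≤ratio*cost = begin
        cost I σ              ≤⟨ sum-mono-≤ (λ j → ≤-trans (completionTime-upper {j} run ≤-refl) (≤-reflexive (+-identityˡ _))) ⟩
        doubleSum A           ≤⟨ doubleSum≤ ⟩
        -- Multiplication by `ratio` preserves the order because `0# ≤ 1# ≤ β ≤ ratio`.
        ratio * doubleSum O   ≤⟨ *-monoˡ-≤-nonNeg (≤-trans (1≤x⇒0≤x 1≤β) (≤-trans (x≤x⊔y β ratio₄) ratio₃≤ratio)) (sum-mono-≤ totalWork≤completionTime) ⟩
        ratio * cost I opt    ∎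

-- An ordered field need not contain a smallest competitive constant, and the second component is
-- vacuous if there is none. The first component therefore asserts the cost inequality itself, and
-- the second follows from it by minimality.
theorem7 : ∀ {c ℓ₁ ℓ₂} (F : OrderedField c ℓ₁ ℓ₂) →
           let open OrderedField F
               open Scheduling F
           in
           (α β : Carrier) → 1# ≤ α → 1# ≤ β →
           let bound = max (α * (1# + 1# ÷ β))
                      (max (1# + 1# ÷ α + 1# ÷ β + 1# ÷ (α * β))
                      (max β
                      (max 2#
                           (1# + 2# ÷ α))))
           in
           IsCompetitive (PCP α β) bound
           × (∀ r → IsCompetitiveRatio (PCP α β) r → r ≤ bound)
theorem7 F α β 1≤α 1≤β = competitive , λ r r-isRatio → IsCompetitiveRatio.smallest r-isRatio _ competitive
  where
  open OrderedField F
  open Scheduling F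
  open PCPAnalysis F α β 1≤α 1≤β
  competitive : IsCompetitive (PCP α β) ratio
  competitive I σ opt run optimal = cost≤ratio*cost I run (IsOptimal.feasible optimal)
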